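{- Let $p \ge 5$ be an integer and let $W_p$ be the wheel graph on $p$ vertices. Then the regular number of $W_p$ is $r(W_p) = \left\lceil \frac{p}{2} \right\rceil$.
   Context: All graphs are finite, simple and undirected. For a set $F$ of edges of a graph $G$, the subgraph induced by $F$, denoted $\langle F \rangle$, is the graph whose edge set is $F$ and whose vertex set is the set of endpoints of edges in $F$ (it need not contain all the vertices of $G$). The regular number $r(G)$ of a graph $G=(V,E)$ is the minimum number of nonempty subsets into which the edge set $E$ can be partitioned so that the subgraph induced by each subset is regular (i.e. all of its vertices have the same degree; different subsets may have different degrees of regularity, and the induced subgraphs need not be connected). The wheel graph $W_p$ on $p$ vertices consists of a cycle on $p-1$ vertices $v_1,\ldots,v_{p-1}$ together with one additional center vertex $v_p$ adjacent to every $v_i$, $1\le i\le p-1$. -}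

module Defs where

open import Level using (0ℓ)
open import Data.Nat using (ℕ; suc; _≤_; _<_)
open import Data.Nat.Properties using (≤-antisym; <-irrefl; _≟_; _<?_; _≤?_; 1+n≢n)
open import Data.Fin using (Fin; toℕ)
open import Data.Fin.Properties using (any?)
open import Data.Fin.Subset using (Subset; ∣_∣; _∈_; ⊤)
open import Data.Fin.Subset.Properties using (∈⊤)
open import Data.Product using (_×_; _,_; ∃; ∃₂)
open import Data.Sum using (_⊎_; inj₁; inj₂; swap)
open import Data.Vec using (tabulate)
open import Data.Vec.Properties using (lookup⇒[]=; lookup∘tabulate)
open import Relation.Nullary using (does; ¬_)
open import Relation.Nullary.Decidable using (dec-true; from-no; _×-dec_; _⊎-dec_)
import Relation.Unary as U
open import Relation.Binary using (Rel; Decidable; Symmetric)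
open import Relation.Binary.PropositionalEquality using (_≡_; sym; trans; cong; subst)

comprehension : ∀ {n} {P : U.Pred (Fin n) 0ℓ} → U.Decidable P → Subset n
comprehension P? = tabulate (λ v → does (P? v))

∈-comprehension : ∀ {n} {P : U.Pred (Fin n) 0ℓ} (P? : U.Decidable P) {v : Fin n} →
                  P v → v ∈ comprehension P?
∈-comprehension P? {v} Pv =
  lookup⇒[]= v (comprehension P?)
    (trans (lookup∘tabulate (λ w → does (P? w)) v) (dec-true (P? v) Pv))

-- A finite simple graph whose vertex set is a subset of Fin n, so that a
-- subgraph on fewer vertices is again a Graph n.
record Graph (n : ℕ) : Set₁ where
  field
    V        : Subset n
    _~_      : Rel (Fin n) 0ℓ
    _~?_     : Decidable _~_
    ~-sym    : Symmetric _~_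
    ~-irrefl : ∀ {v} → ¬ (v ~ v)
    ~⇒∈V     : ∀ {u v} → u ~ v → u ∈ V

  degree : Fin n → ℕ
  degree v = ∣ comprehension (v ~?_) ∣

Regular : ∀ {n} → Graph n → Set
Regular G = ∃ λ d → ∀ {v} → v ∈ V → degree v ≡ d
  where open Graph G

-- A set of (unordered) edges, given as a symmetric relation inside adjacency.
record EdgeSet {n : ℕ} (G : Graph n) : Set₁ where
  open Graph G using (_~_)
  field
    Has     : Rel (Fin n) 0ℓ
    has?    : Decidable Has
    has-sym : Symmetric Has
    has⇒~   : ∀ {u v} → Has u v → u ~ v

⟨_⟩ : ∀ {n} {G : Graph n} → EdgeSet G → Graph n
⟨_⟩ {G = G} F = record
  { V        = comprehension endpoint?
  ; _~_      = Has
  ; _~?_     = has?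
  ; ~-sym    = has-sym
  ; ~-irrefl = λ vv → Graph.~-irrefl G (has⇒~ vv)
  ; ~⇒∈V     = λ {_} {v} uv → ∈-comprehension endpoint? (v , uv)
  }
  where
  open EdgeSet F
  endpoint? : U.Decidable (λ u → ∃ λ v → Has u v)
  endpoint? u = any? (has? u)

record EdgePartition {n : ℕ} (G : Graph n) (k : ℕ) : Set₁ where
  open Graph G using (_~_)
  field
    part     : Fin k → EdgeSet G
    nonempty : ∀ i → ∃₂ λ u v → EdgeSet.Has (part i) u v
    disjoint : ∀ {i j u v} → EdgeSet.Has (part i) u v → EdgeSet.Has (part j) u v → i ≡ j
    cover    : ∀ {u v} → u ~ v → ∃ λ i → EdgeSet.Has (part i) u v

RegularlyPartitionable : ∀ {n} → Graph n → ℕ → Set₁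
RegularlyPartitionable G k =
  ∃ λ (P : EdgePartition G k) → ∀ i → Regular ⟨ EdgePartition.part P i ⟩

-- "r(G) = r": r is the least size of a partition into regular parts.
IsRegularNumber : ∀ {n} → Graph n → ℕ → Set₁
IsRegularNumber G r =
  RegularlyPartitionable G r × (∀ k → RegularlyPartitionable G k → r ≤ k)

IsRegularNumber-unique : ∀ {n} {G : Graph n} {r s} →
                         IsRegularNumber G r → IsRegularNumber G s → r ≡ s
IsRegularNumber-unique (Pr , minr) (Ps , mins) = ≤-antisym (minr _ Ps) (mins _ Pr)

-- Vertices carry the labels 1, …, p; the centre is the one labelled p.
label : ∀ {p} → Fin p → ℕ
label v = suc (toℕ v)

-- One orientation of each edge: v_i v_{i+1} with i + 1 ≤ p - 1, the closing
-- edge v_{p-1} v_1, and the spokes v_i v_p.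
WheelArc : ∀ p → Rel (Fin p) 0ℓ
WheelArc p u v = (label v ≡ suc (label u) × label v < p)
               ⊎ (suc (label u) ≡ p × label v ≡ 1)
               ⊎ (label u < p × label v ≡ p)

wheelArc? : ∀ p → Decidable (WheelArc p)
wheelArc? p u v = ((label v ≟ suc (label u)) ×-dec (label v <? p))
                ⊎-dec ((suc (label u) ≟ p) ×-dec (label v ≟ 1))
                ⊎-dec ((label u <? p) ×-dec (label v ≟ p))

wheelArc-irrefl : ∀ {p} → 4 ≤ p → ∀ {v} → ¬ WheelArc p v v
wheelArc-irrefl _ (inj₁ (l≡1+l , _)) = 1+n≢n (sym l≡1+l)
wheelArc-irrefl 4≤p (inj₂ (inj₁ (1+l≡p , l≡1))) =
  from-no (4 ≤? 2) (subst (4 ≤_) (trans (sym 1+l≡p) (cong suc l≡1)) 4≤p)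
wheelArc-irrefl _ (inj₂ (inj₂ (l<p , l≡p))) = <-irrefl l≡p l<p

-- The bound makes the rim v_1, …, v_{p-1} a genuine cycle (of length at least 3).
wheel : ∀ p → 4 ≤ p → Graph p
wheel p 4≤p = record
  { V        = ⊤
  ; _~_      = λ u v → WheelArc p u v ⊎ WheelArc p v u
  ; _~?_     = λ u v → wheelArc? p u v ⊎-dec wheelArc? p v u
  ; ~-sym    = swap
  ; ~-irrefl = λ { (inj₁ a) → wheelArc-irrefl 4≤p a ; (inj₂ a) → wheelArc-irrefl 4≤p a }
  ; ~⇒∈V     = λ _ → ∈⊤
  }

{-# OPTIONS --safe #-}

-- Lower bound. If the centre had degree at least 3 in a regular part, every rim
-- vertex reached would have all its three edges in that part; running round the
-- rim, the part would be the whole wheel, which is not regular. So every part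
-- has at most two spokes. If the part of the spoke at u has two, it is 2-regular
-- and misses one rim edge at u; the part of that edge has degree 1 at u, hence
-- at most one spoke. Counting spokes, p - 1 ≤ 2k - 1.
--
-- Upper bound. Remove a suitable (near-)perfect matching. Every rim vertex is left with
-- two edges, and the rest splits into cycles through the centre.

module Submission where

open import Defs
open import Data.Nat
open import Data.Nat.Properties
open import Data.Fin using (Fin; zero; suc; toℕ; fromℕ; fromℕ<; inject₁; combine)
import Data.Fin.Properties as F
open import Data.Fin.Subset using (Subset; ∣_∣; _∪_; _-_; ⁅_⁆; ⋃; inside; outside)
  renaming (_∈_ to _∈ₛ_)
import Data.Fin.Subset.Properties as S
open import Data.List using (List; []; _∷_; length; map; filter; allFin)
open import Data.List.Properties using (filter-notAll; length-map; length-tabulate)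
open import Data.List.Membership.Propositional using (_∈_)
open import Data.List.Membership.Propositional.Properties using (∈-filter⁺)
open import Data.List.Relation.Unary.All using (All; []; _∷_; all?)
import Data.List.Relation.Unary.All as All
open import Data.List.Relation.Unary.All.Properties using (¬All⇒Any¬; map⁺)
open import Data.List.Relation.Unary.AllPairs using ([]; _∷_)
open import Data.List.Relation.Unary.Any using (here; there)
open import Data.List.Relation.Unary.Unique.Propositional using (Unique)
import Data.List.Relation.Unary.Unique.Propositional.Properties as Unique
open import Data.Product using (_×_; _,_; ∃; ∃₂; proj₁; proj₂)
open import Data.Sum using (_⊎_; inj₁; inj₂)
open import Data.Vec using ([]; _∷_)
open import Data.Vec.Properties using ([]=⇒lookup; lookup∘tabulate)
open import Function using (_∘_)
open import Level using (0ℓ)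
open import Relation.Binary using (tri<; tri≈; tri>)
open import Relation.Binary.PropositionalEquality
open import Relation.Nullary using (¬_; Dec; yes; no; does; contradiction)
open import Relation.Nullary.Decidable using (¬?; _×-dec_)
import Relation.Unary as U

-- Cardinality of subsets against length of lists.

∈-comprehension⁻ : ∀ {n} {P : U.Pred (Fin n) 0ℓ} (P? : U.Decidable P) {v : Fin n} →
                   v ∈ₛ comprehension P? → P v
∈-comprehension⁻ P? {v} v∈
  with P? v | trans (sym (lookup∘tabulate (does ∘ P?) v)) ([]=⇒lookup v∈)
... | yes Pv | _  = Pv
... | no _   | ()

∣p∪q∣≤∣p∣+∣q∣ : ∀ {n} (p q : Subset n) → ∣ p ∪ q ∣ ≤ ∣ p ∣ + ∣ q ∣
∣p∪q∣≤∣p∣+∣q∣ []            []            = z≤n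
∣p∪q∣≤∣p∣+∣q∣ (outside ∷ p) (outside ∷ q) = ∣p∪q∣≤∣p∣+∣q∣ p q
∣p∪q∣≤∣p∣+∣q∣ (outside ∷ p) (inside  ∷ q) =
  ≤-trans (s≤s (∣p∪q∣≤∣p∣+∣q∣ p q)) (≤-reflexive (sym (+-suc ∣ p ∣ ∣ q ∣)))
∣p∪q∣≤∣p∣+∣q∣ (inside  ∷ p) (outside ∷ q) = s≤s (∣p∪q∣≤∣p∣+∣q∣ p q)
∣p∪q∣≤∣p∣+∣q∣ (inside  ∷ p) (inside  ∷ q) =
  s≤s (≤-trans (∣p∪q∣≤∣p∣+∣q∣ p q) (+-monoʳ-≤ ∣ p ∣ (n≤1+n ∣ q ∣)))

∣⋃⁅xs⁆∣≤length : ∀ {n} (xs : List (Fin n)) → ∣ ⋃ (map ⁅_⁆ xs) ∣ ≤ length xs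
∣⋃⁅xs⁆∣≤length {n} []   = ≤-reflexive (S.∣⊥∣≡0 n)
∣⋃⁅xs⁆∣≤length (x ∷ xs) =
  ≤-trans (∣p∪q∣≤∣p∣+∣q∣ ⁅ x ⁆ _)
          (+-mono-≤ (≤-reflexive (S.∣⁅x⁆∣≡1 x)) (∣⋃⁅xs⁆∣≤length xs))

∈⇒∈⋃⁅⁆ : ∀ {n} {x : Fin n} {xs} → x ∈ xs → x ∈ₛ ⋃ (map ⁅_⁆ xs)
∈⇒∈⋃⁅⁆ {x = x} (here refl)  = S.x∈p∪q⁺ (inj₁ (S.x∈⁅x⁆ x))
∈⇒∈⋃⁅⁆         (there x∈xs) = S.x∈p∪q⁺ (inj₂ (∈⇒∈⋃⁅⁆ x∈xs))

length≤∣p∣ : ∀ {n} {p : Subset n} {xs} → Unique xs → All (_∈ₛ p) xs → length xs ≤ ∣ p ∣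
length≤∣p∣ []            []           = z≤n
length≤∣p∣ (x∉xs ∷ uniq) (x∈p ∷ xs∈p) =
  ≤-trans (s≤s (length≤∣p∣ uniq (All.zipWith (λ (x≢y , y∈p) → S.x∈p∧x≢y⇒x∈p-y y∈p (x≢y ∘ sym))
                                             (x∉xs , xs∈p))))
          (S.x∈p⇒∣p-x∣<∣p∣ x∈p)

-- Degrees read off from lists of neighbours.

module _ {n} (G : Graph n) where

  open Graph G

  degree≤length : ∀ {v xs} → (∀ {w} → v ~ w → w ∈ xs) → degree v ≤ length xs
  degree≤length {v} {xs} cov =
    ≤-trans (S.p⊆q⇒∣p∣≤∣q∣ (∈⇒∈⋃⁅⁆ ∘ cov ∘ ∈-comprehension⁻ (v ~?_))) (∣⋃⁅xs⁆∣≤length xs)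

  length≤degree : ∀ {v xs} → Unique xs → All (v ~_) xs → length xs ≤ degree v
  length≤degree {v} uniq adj = length≤∣p∣ uniq (All.map (∈-comprehension (v ~?_)) adj)

  degree≡length : ∀ {v xs} → Unique xs → All (v ~_) xs → (∀ {w} → v ~ w → w ∈ xs) →
                  degree v ≡ length xs
  degree≡length uniq adj cov = ≤-antisym (degree≤length cov) (length≤degree uniq adj)

  -- If some entry of `xs` were no neighbour, filtering would leave a strictly shorter list that
  -- still covers all neighbours, and the degree would fall below `length xs`.
  covering-tight : ∀ {v} xs → (∀ {w} → v ~ w → w ∈ xs) → length xs ≤ degree v → All (v ~_) xs
  covering-tight {v} xs cov tight with all? (v ~?_) xs
  ... | yes adj = adj
  ... | no ¬adj = contradiction
    (≤-trans tight (degree≤length (λ vw → ∈-filter⁺ (v ~?_) (cov vw) vw)))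
    (<⇒≱ (filter-notAll (v ~?_) xs (¬All⇒Any¬ (v ~?_) xs ¬adj)))

pair-unique : ∀ {A : Set} {x y : A} → x ≢ y → Unique (x ∷ y ∷ [])
pair-unique x≢y = (x≢y ∷ []) ∷ [] ∷ []

triple-unique : ∀ {A : Set} {x y z : A} → x ≢ y → x ≢ z → y ≢ z → Unique (x ∷ y ∷ z ∷ [])
triple-unique x≢y x≢z y≢z = (x≢y ∷ x≢z ∷ []) ∷ pair-unique y≢z

-- Counting with fibres of size at most two.

-- Number the (at most two) members of each fibre by 0 and 1; slot 1 of the
-- fibre over j stays free.
module _ {n k} (f : Fin n → Fin k)
         (fibre≤2 : ∀ {x y z} → toℕ x < toℕ y → toℕ y < toℕ z → f x ≡ f y → f y ≡ f z → x ≡ y)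
         (j : Fin k) (fibre≤1 : ∀ {x y} → f x ≡ j → f y ≡ j → x ≡ y) where

  private
    Second : Fin n → Set
    Second x = ∃ λ w → toℕ w < toℕ x × f w ≡ f x

    second? : U.Decidable Second
    second? x = F.any? λ w → (toℕ w <? toℕ x) ×-dec (f w F.≟ f x)

    rank : ∀ {P : Set} → Dec P → Fin 2
    rank (yes _) = suc zero
    rank (no _)  = zero

    slot : Fin (suc n) → Fin (k * 2)
    -- The extra point `zero` takes the free slot, which makes the bound on `n` strict.
    slot zero    = combine j (suc zero)
    slot (suc x) = combine (f x) (rank (second? x))

    rank-yes : ∀ {P : Set} (P? : Dec P) → rank P? ≡ suc zero → P
    rank-yes (yes p) _ = p

    yes-rank : ∀ {P : Set} (P? : Dec P) → P → rank P? ≡ suc zero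
    yes-rank (yes _) _ = refl
    yes-rank (no ¬p) p = contradiction p ¬p

    -- The later `y` has rank 1; with equal ranks `x` too has some `w` before it, and then `w`, `x`,
    -- `y` are three members of one fibre.
    same-slot-≮ : ∀ {x y} → f x ≡ f y → rank (second? x) ≡ rank (second? y) → ¬ toℕ x < toℕ y
    same-slot-≮ {x} {y} fx≡fy eq x<y
      with w , w<x , fw≡fx ← rank-yes (second? x) (trans eq (yes-rank (second? y) (x , x<y , fx≡fy)))
      = <⇒≢ w<x (cong toℕ (fibre≤2 w<x x<y fw≡fx fx≡fy))

    free-slot : ∀ {x} → slot (suc x) ≢ slot zero
    free-slot {x} eq
      with fx≡j , r≡1 ← F.combine-injective (f x) (rank (second? x)) j (suc zero) eq
      with w , w<x , fw≡fx ← rank-yes (second? x) r≡1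
      = <⇒≢ w<x (cong toℕ (fibre≤1 (trans fw≡fx fx≡j) fx≡j))

    slot-injective : ∀ {x y} → slot x ≡ slot y → x ≡ y
    slot-injective {zero}  {zero}  _  = refl
    slot-injective {zero}  {suc y} eq = contradiction (sym eq) free-slot
    slot-injective {suc x} {zero}  eq = contradiction eq free-slot
    slot-injective {suc x} {suc y} eq
      with fx≡fy , rx≡ry ← F.combine-injective (f x) (rank (second? x)) (f y) (rank (second? y)) eq
      with F.<-cmp x y
    ... | tri< x<y _ _ = contradiction x<y (same-slot-≮ fx≡fy rx≡ry)
    ... | tri≈ _ x≡y _ = cong suc x≡y
    ... | tri> _ _ y<x = contradiction y<x (same-slot-≮ (sym fx≡fy) (sym rx≡ry))

  fibres≤2⇒size<2k : suc n ≤ k * 2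
  fibres≤2⇒size<2k = F.injective⇒≤ slot-injective

-- Pairing the naturals by their halves.

-- The alternatives are `a` even, where `suc a` completes the pair of `a`, and `a` odd, where it
-- opens a new pair.
half-step : ∀ a → ⌊ suc a /2⌋ ≡ ⌊ a /2⌋ ⊎ ⌊ suc a /2⌋ ≡ suc ⌊ a /2⌋
half-step 0             = inj₁ refl
half-step 1             = inj₂ refl
half-step (suc (suc a)) with half-step a
... | inj₁ eq = inj₁ (cong suc eq)
... | inj₂ eq = inj₂ (cong suc eq)

-- Only two numbers share a half. This yields both the uniqueness of partners in the matching and
-- the count of spokes of a given hue.
half-fibre : ∀ a b c → ⌊ a /2⌋ ≡ ⌊ b /2⌋ → ⌊ a /2⌋ ≡ ⌊ c /2⌋ → a ≡ b ⊎ a ≡ c ⊎ b ≡ c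
half-fibre 0 0 _ _ _ = inj₁ refl
half-fibre 0 1 0 _ _ = inj₂ (inj₁ refl)
half-fibre 0 1 1 _ _ = inj₂ (inj₂ refl)
half-fibre 1 1 _ _ _ = inj₁ refl
half-fibre 1 0 0 _ _ = inj₂ (inj₂ refl)
half-fibre 1 0 1 _ _ = inj₂ (inj₁ refl)
half-fibre (suc (suc a)) (suc (suc b)) (suc (suc c)) ab ac
  with half-fibre a b c (suc-injective ab) (suc-injective ac)
... | inj₁ a≡b        = inj₁ (cong (2 +_) a≡b)
... | inj₂ (inj₁ a≡c) = inj₂ (inj₁ (cong (2 +_) a≡c))
... | inj₂ (inj₂ b≡c) = inj₂ (inj₂ (cong (2 +_) b≡c))

half-cancel-< : ∀ {a b} → ⌊ a /2⌋ < ⌊ b /2⌋ → a < b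
half-cancel-< ha<hb = ≰⇒> (λ b≤a → <⇒≱ ha<hb (⌊n/2⌋-mono b≤a))

-- Adjacency in the wheel as arithmetic.

-- The rim vertices are 0, …, n - 1 and the centre is n.
module Wheel {n} (4≤n : 4 ≤ n) (4≤p : 4 ≤ suc n) where

  W : Graph (suc n)
  W = wheel (suc n) 4≤p

  open Graph W using (_~_)

  Follows : ℕ → ℕ → Set
  Follows a b = (b ≡ suc a × b < n) ⊎ (suc a ≡ n × b ≡ 0)

  Adjacent : ℕ → ℕ → Set
  Adjacent a b = Follows a b ⊎ Follows b a ⊎ (a < n × b ≡ n) ⊎ (b < n × a ≡ n)

  n≢ : ∀ {m} → m < 4 → n ≢ m
  n≢ m<4 refl = <⇒≱ m<4 4≤n

  follows-source : ∀ {a b} → Follows a b → a < n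
  follows-source (inj₁ (refl , b<n)) = <-trans (n<1+n _) b<n
  follows-source (inj₂ (refl , _))   = n<1+n _

  follows-target : ∀ {a b} → Follows a b → b < n
  follows-target (inj₁ (_ , b<n))  = b<n
  follows-target (inj₂ (_ , refl)) = ≤-trans (s≤s z≤n) 4≤n

  follows-functional : ∀ {a b c} → Follows a b → Follows a c → b ≡ c
  follows-functional (inj₁ (refl , _))   (inj₁ (refl , _))    = refl
  follows-functional (inj₁ (refl , b<n)) (inj₂ (b≡n , _))     = contradiction b≡n (<⇒≢ b<n)
  follows-functional (inj₂ (c≡n , _))    (inj₁ (refl , c<n))  = contradiction c≡n (<⇒≢ c<n)
  follows-functional (inj₂ (_ , refl))   (inj₂ (_ , refl))    = refl

  follows-injective : ∀ {a b c} → Follows a c → Follows b c → a ≡ b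
  follows-injective (inj₁ (refl , _)) (inj₁ (eq , _))   = suc-injective eq
  follows-injective (inj₂ (a≡ , _))   (inj₂ (b≡ , _))   = suc-injective (trans a≡ (sym b≡))
  follows-injective (inj₁ (refl , _)) (inj₂ (_ , ()))
  follows-injective (inj₂ (_ , refl)) (inj₁ (() , _))

  -- A violation would need a rim of length one or two. Hence the two rim neighbours of a vertex are
  -- distinct.
  follows-asym : ∀ {a b} → Follows a b → ¬ Follows b a
  follows-asym (inj₁ (refl , _))   (inj₁ (eq , _))     = m≢1+n+m _ eq
  follows-asym (inj₁ (refl , _))   (inj₂ (2≡n , refl)) = n≢ (s≤s (s≤s (s≤s z≤n))) (sym 2≡n)
  follows-asym (inj₂ (2≡n , refl)) (inj₁ (refl , _))   = n≢ (s≤s (s≤s (s≤s z≤n))) (sym 2≡n)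
  follows-asym (inj₂ (1≡n , refl)) (inj₂ (_ , refl))   = n≢ (s≤s (s≤s z≤n)) (sym 1≡n)

  ~⇒Adjacent : ∀ {u v} → u ~ v → Adjacent (toℕ u) (toℕ v)
  ~⇒Adjacent (inj₁ (inj₁ (eq , s≤s v<n)))        = inj₁ (inj₁ (suc-injective eq , v<n))
  ~⇒Adjacent (inj₁ (inj₂ (inj₁ (eq , eq′))))     = inj₁ (inj₂ (suc-injective eq , suc-injective eq′))
  ~⇒Adjacent (inj₁ (inj₂ (inj₂ (s≤s u<n , eq)))) = inj₂ (inj₂ (inj₁ (u<n , suc-injective eq)))
  ~⇒Adjacent (inj₂ (inj₁ (eq , s≤s u<n)))        = inj₂ (inj₁ (inj₁ (suc-injective eq , u<n)))
  ~⇒Adjacent (inj₂ (inj₂ (inj₁ (eq , eq′))))     = inj₂ (inj₁ (inj₂ (suc-injective eq , suc-injective eq′)))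
  ~⇒Adjacent (inj₂ (inj₂ (inj₂ (s≤s v<n , eq)))) = inj₂ (inj₂ (inj₂ (v<n , suc-injective eq)))

  Adjacent⇒~ : ∀ {u v} → Adjacent (toℕ u) (toℕ v) → u ~ v
  Adjacent⇒~ (inj₁ (inj₁ (eq , v<n)))         = inj₁ (inj₁ (cong suc eq , s≤s v<n))
  Adjacent⇒~ (inj₁ (inj₂ (eq , eq′)))         = inj₁ (inj₂ (inj₁ (cong suc eq , cong suc eq′)))
  Adjacent⇒~ (inj₂ (inj₁ (inj₁ (eq , u<n))))  = inj₂ (inj₁ (cong suc eq , s≤s u<n))
  Adjacent⇒~ (inj₂ (inj₁ (inj₂ (eq , eq′))))  = inj₂ (inj₂ (inj₁ (cong suc eq , cong suc eq′)))
  Adjacent⇒~ (inj₂ (inj₂ (inj₁ (u<n , eq))))  = inj₁ (inj₂ (inj₂ (s≤s u<n , cong suc eq)))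
  Adjacent⇒~ (inj₂ (inj₂ (inj₂ (v<n , eq))))  = inj₂ (inj₂ (inj₂ (s≤s v<n , cong suc eq)))

  centre : Fin (suc n)
  centre = fromℕ n

  toℕ≡n⇒centre : ∀ {u : Fin (suc n)} → toℕ u ≡ n → u ≡ centre
  toℕ≡n⇒centre u≡n = F.toℕ-injective (trans u≡n (sym (F.toℕ-fromℕ n)))

  rim≢centre : ∀ {u : Fin (suc n)} → toℕ u < n → u ≢ centre
  rim≢centre u<n refl = <⇒≢ u<n (F.toℕ-fromℕ n)

  rim~centre : ∀ {u} → toℕ u < n → u ~ centre
  rim~centre u<n = Adjacent⇒~ (inj₂ (inj₂ (inj₁ (u<n , F.toℕ-fromℕ n))))

  ~centre⇒rim : ∀ {u} → u ~ centre → toℕ u < n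
  ~centre⇒rim {u} u~c = ≤∧≢⇒< (F.toℕ≤pred[n] u)
    λ u≡n → Graph.~-irrefl W (subst (_~ centre) (toℕ≡n⇒centre u≡n) u~c)

  inject₁<n : ∀ (x : Fin n) → toℕ (inject₁ x) < n
  inject₁<n x = subst (_< n) (sym (F.toℕ-inject₁ x)) (F.toℕ<n x)

  vertex : ∀ {a} → a < n → ∃ λ (u : Fin (suc n)) → toℕ u ≡ a
  vertex a<n = fromℕ< (m<n⇒m<1+n a<n) , F.toℕ-fromℕ< (m<n⇒m<1+n a<n)

  last : suc (pred n) ≡ n
  last = suc-pred n ⦃ >-nonZero (≤-trans (s≤s z≤n) 4≤n) ⦄

  successor : ∀ {u : Fin (suc n)} → toℕ u < n → ∃ λ (v : Fin (suc n)) → Follows (toℕ u) (toℕ v)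
  successor {u} u<n with m≤n⇒m<n∨m≡n u<n
  ... | inj₁ 1+u<n with v , v≡ ← vertex 1+u<n = v , inj₁ (v≡ , subst (_< n) (sym v≡) 1+u<n)
  ... | inj₂ 1+u≡n = zero , inj₂ (1+u≡n , refl)

  predecessor : ∀ {u : Fin (suc n)} → toℕ u < n → ∃ λ (v : Fin (suc n)) → Follows (toℕ v) (toℕ u)
  predecessor {zero}  0<n with v , v≡ ← vertex (≤-reflexive last) =
    v , inj₂ (trans (cong suc v≡) last , refl)
  predecessor {suc u} u<n = inject₁ u , inj₁ (cong suc (sym (F.toℕ-inject₁ u)) , u<n)

  -- The order is left open so that the neighbour with a special role can come first: the one whose
  -- edge is missing from a part, or the matched partner.
  record RimNeighbours (u x y z : Fin (suc n)) : Set where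
    field
      x~    : u ~ x
      y~    : u ~ y
      z~    : u ~ z
      x≢y   : x ≢ y
      x≢z   : x ≢ z
      y≢z   : y ≢ z
      cover : ∀ {w} → u ~ w → w ∈ x ∷ y ∷ z ∷ []

  rim-neighbours : ∀ {u x y} → Follows (toℕ u) (toℕ x) → Follows (toℕ y) (toℕ u) →
                   RimNeighbours u x y centre
  rim-neighbours {u} {x} {y} ux yu = record
    { x~    = Adjacent⇒~ (inj₁ ux)
    ; y~    = Adjacent⇒~ (inj₂ (inj₁ yu))
    ; z~    = rim~centre (follows-source ux)
    ; x≢y   = λ { refl → follows-asym ux yu }
    ; x≢z   = rim≢centre (follows-target ux)
    ; y≢z   = rim≢centre (follows-source yu)
    ; cover = cover ∘ ~⇒Adjacent
    }
    where
    cover : ∀ {w} → Adjacent (toℕ u) (toℕ w) → w ∈ x ∷ y ∷ centre ∷ []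
    cover (inj₁ uw)                      = here (F.toℕ-injective (follows-functional uw ux))
    cover (inj₂ (inj₁ wu))               = there (here (F.toℕ-injective (follows-injective wu yu)))
    cover (inj₂ (inj₂ (inj₁ (_ , w≡n)))) = there (there (here (toℕ≡n⇒centre w≡n)))
    cover (inj₂ (inj₂ (inj₂ (_ , u≡n)))) = contradiction u≡n (<⇒≢ (follows-source ux))

  swap₁₂ : ∀ {u x y z} → RimNeighbours u x y z → RimNeighbours u y x z
  swap₁₂ N = record
    { x~ = y~ ; y~ = x~ ; z~ = z~ ; x≢y = x≢y ∘ sym ; x≢z = y≢z ; y≢z = x≢z
    ; cover = λ uw → swapped (cover uw) }
    where
    open RimNeighbours N
    swapped : ∀ {w x y z} → w ∈ x ∷ y ∷ z ∷ [] → w ∈ y ∷ x ∷ z ∷ []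
    swapped (here w≡x)                  = there (here w≡x)
    swapped (there (here w≡y))          = here w≡y
    swapped (there (there w∈))          = there (there w∈)

  rotate : ∀ {u x y z} → RimNeighbours u x y z → RimNeighbours u z x y
  rotate N = record
    { x~ = z~ ; y~ = x~ ; z~ = y~ ; x≢y = x≢z ∘ sym ; x≢z = y≢z ∘ sym ; y≢z = x≢y
    ; cover = λ uw → rotated (cover uw) }
    where
    open RimNeighbours N
    rotated : ∀ {w x y z} → w ∈ x ∷ y ∷ z ∷ [] → w ∈ z ∷ x ∷ y ∷ []
    rotated (here w≡x)                 = there (here w≡x)
    rotated (there (here w≡y))         = there (there (here w≡y))
    rotated (there (there (here w≡z))) = here w≡z

  -- Regular parts that contain a spoke.

  module Part (F : EdgeSet W) (regular : Regular ⟨ F ⟩) where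

    open EdgeSet F
    open Graph ⟨ F ⟩ using (degree; ~⇒∈V)

    equal-degrees : ∀ {u v w x} → Has u v → Has w x → degree u ≡ degree w
    equal-degrees uv wx = trans (proj₂ regular (~⇒∈V uv)) (sym (proj₂ regular (~⇒∈V wx)))

    spoke-degree : ∀ {u} → Has u centre → degree u ≡ degree centre
    spoke-degree uc = equal-degrees uc (has-sym uc)

    -- A rim vertex has only three neighbours in the wheel, so `covering-tight` applies.
    full : ∀ {u x y z} → RimNeighbours u x y z → 3 ≤ degree u → All (Has u) (x ∷ y ∷ z ∷ [])
    full N = covering-tight ⟨ F ⟩ _ (RimNeighbours.cover N ∘ has⇒~)

    module _ (3≤d : 3 ≤ degree centre) where

      -- The spoke at `u` gives `u` the degree of the centre, so all edges at `u` lie in the part,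
      -- among them `u v`. This edge passes the degree on to `v`, whose spoke is then in the part as
      -- well.
      next-spoke : ∀ {u v} → Follows (toℕ u) (toℕ v) → Has u centre → Has v centre
      next-spoke {u} {v} uv uc
        with _ , tu ← predecessor (follows-source uv)
        with _ , vw ← successor (follows-target uv)
        with uv∈F ∷ _ ← full (rim-neighbours uv tu)
                             (≤-trans 3≤d (≤-reflexive (sym (spoke-degree uc))))
        with _ ∷ _ ∷ vc ∷ [] ← full (rim-neighbours vw uv)
                                    (≤-trans 3≤d (≤-reflexive (trans (sym (spoke-degree uc))
                                       (equal-degrees uv∈F (has-sym uv∈F)))))
        = vc

      Spoke : ℕ → Set
      Spoke a = ∃ λ u → toℕ u ≡ a × Has u centre

      climb : ∀ {a b} → a ≤′ b → b < n → Spoke a → Spoke b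
      climb ≤′-refl       _     sa = sa
      climb (≤′-step a≤b) 1+b<n sa
        with u , refl , uc ← climb a≤b (<-trans (n<1+n _) 1+b<n) sa
        with v , v≡ ← vertex 1+b<n
        = v , v≡ , next-spoke (inj₁ (v≡ , subst (_< n) (sym v≡) 1+b<n)) uc

      all-spokes : ∀ {u v} → Has u centre → toℕ v < n → Has v centre
      all-spokes {u} {v} uc v<n
        -- Climb to the last rim vertex, cross the closing edge to vertex 0, then climb to `v`.
        with w , w≡ , wc ← climb (≤⇒≤′ (<⇒≤pred (~centre⇒rim (has⇒~ uc)))) (≤-reflexive last) (u , refl , uc)
        with x , x≡v , xc ← climb z≤′n v<n
               (zero , refl , next-spoke {w} {zero} (inj₂ (trans (cong suc w≡) last , refl)) wc)
        = subst (λ y → Has y centre) (F.toℕ-injective x≡v) xc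

    -- Otherwise all `n` spokes lie in the part and the centre has degree at least 4, against at
    -- most 3 at a rim vertex. For `n` equal to 3 the wheel is the complete graph on four vertices,
    -- which is regular.
    spoke⇒degree≤2 : ∀ {u} → Has u centre → degree centre ≤ 2
    spoke⇒degree≤2 {u} uc = ≮⇒≥ λ 3≤d →
      let spokes = map inject₁ (allFin n)
          n≤d : n ≤ degree centre
          n≤d = subst (_≤ degree centre) (trans (length-map inject₁ (allFin n)) (length-tabulate (λ i → i)))
                  (length≤degree ⟨ F ⟩ {xs = spokes} (Unique.map⁺ F.inject₁-injective (Unique.allFin⁺ n))
                    (map⁺ (All.universal (λ i → has-sym (all-spokes 3≤d uc (inject₁<n i))) (allFin n))))
          _ , uv = successor (~centre⇒rim (has⇒~ uc))
          _ , tu = predecessor (~centre⇒rim (has⇒~ uc))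
          d≤3 = degree≤length ⟨ F ⟩ (RimNeighbours.cover (rim-neighbours uv tu) ∘ has⇒~)
      in <⇒≱ 4≤n (≤-trans n≤d (≤-trans (≤-reflexive (sym (spoke-degree uc))) d≤3))

  -- The lower bound.

  module LowerBound {k} (P : EdgePartition W k)
                    (regular : ∀ i → Regular ⟨ EdgePartition.part P i ⟩) where

    open EdgePartition P
    open Part using (spoke-degree; spoke⇒degree≤2)

    Has : Fin k → Fin (suc n) → Fin (suc n) → Set
    Has i = EdgeSet.Has (part i)

    has-sym : ∀ {i u v} → Has i u v → Has i v u
    has-sym {i} = EdgeSet.has-sym (part i)

    degree : Fin k → Fin (suc n) → ℕ
    degree i = Graph.degree ⟨ part i ⟩

    Sparse : Fin k → Set
    Sparse j = ∀ {v w} → Has j v centre → Has j w centre → v ≡ w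

    pair⇒2≤degree : ∀ {i v w} → v ≢ w → Has i v centre → Has i w centre → 2 ≤ degree i centre
    pair⇒2≤degree {i} v≢w vc wc =
      length≤degree ⟨ part i ⟩ (pair-unique v≢w) (has-sym vc ∷ has-sym wc ∷ [])

    -- At u, the part i consists of the spoke and one rim edge u y, so u is a
    -- leaf of the part containing u x; that part is therefore 1-regular.
    leaf⇒sparse : ∀ {i u x y} → RimNeighbours u x y centre → 2 ≤ degree i u → Has i u centre →
                  ¬ Has i u x → ∃ Sparse
    leaf⇒sparse {i} {u} {x} {y} N 2≤d uc ¬ux = j , sparse
      where
      open RimNeighbours N using (x~)
      j = proj₁ (cover x~)
      uxⱼ = proj₂ (cover x~)

      uy : Has i u y
      uy = All.head (covering-tight ⟨ part i ⟩ (y ∷ centre ∷ []) others 2≤d)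
        where
        others : ∀ {w} → Has i u w → w ∈ y ∷ centre ∷ []
        others uw with RimNeighbours.cover N (EdgeSet.has⇒~ (part i) uw)
        ... | here refl = contradiction uw ¬ux
        ... | there w∈  = w∈

      -- A common edge would identify the two parts and so put `u x` into part `i`.
      ¬both : ∀ {w} → Has i u w → ¬ Has j u w
      ¬both uwᵢ uwⱼ = ¬ux (subst (λ i → Has i u x) (sym (disjoint uwᵢ uwⱼ)) uxⱼ)

      leaf : ∀ {w} → Has j u w → w ∈ x ∷ []
      leaf uw with RimNeighbours.cover N (EdgeSet.has⇒~ (part j) uw)
      ... | here refl                 = here refl
      ... | there (here refl)         = contradiction uw (¬both uy)
      ... | there (there (here refl)) = contradiction uw (¬both uc)

      sparse : Sparse j
      sparse {v} {w} vc wc with v F.≟ w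
      ... | yes v≡w = v≡w
      ... | no  v≢w = contradiction
        (≤-trans (pair⇒2≤degree v≢w vc wc)
          (≤-trans (≤-reflexive (Part.equal-degrees (part j) (regular j) (has-sym vc) uxⱼ))
                   (degree≤length ⟨ part j ⟩ leaf)))
        λ { (s≤s ()) }

    -- Look at the part of the spoke at vertex 0. Either it has no other spoke, or its degree is 2
    -- and it misses a rim edge at 0, whose part is then sparse.
    sparse-part : ∃ Sparse
    sparse-part with i , uc ← cover (rim~centre {zero} (≤-trans (s≤s z≤n) 4≤n))
      with F.any? (λ w → ¬? (zero F.≟ w) ×-dec EdgeSet.has? (part i) w centre)
    ... | no unique = i , λ vc wc → trans (sym (only vc)) (only wc)
      where
      only : ∀ {w} → Has i w centre → zero ≡ w
      only {w} wc with zero F.≟ w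
      ... | yes 0≡w = 0≡w
      ... | no  0≢w = contradiction (w , 0≢w , wc) unique
    ... | yes (w , 0≢w , wc)
      with x , ux ← successor {zero} (≤-trans (s≤s z≤n) 4≤n)
      with y , yu ← predecessor {zero} (≤-trans (s≤s z≤n) 4≤n)
      = found
      where
      N = rim-neighbours {zero} ux yu
      d≡ = spoke-degree (part i) (regular i) uc
      2≤d = ≤-trans (pair⇒2≤degree 0≢w uc wc) (≤-reflexive (sym d≡))
      found : ∃ Sparse
      found with EdgeSet.has? (part i) zero x | EdgeSet.has? (part i) zero y
      ... | no ¬ux | _      = leaf⇒sparse N 2≤d uc ¬ux
      ... | _      | no ¬uy = leaf⇒sparse (swap₁₂ N) 2≤d uc ¬uy
      -- With both rim edges and the spoke, vertex 0 would have degree 3 in a part of degree at most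
      -- 2.
      ... | yes ux∈ | yes uy∈ = contradiction
        (≤-trans (≤-reflexive d≡) (spoke⇒degree≤2 (part i) (regular i) uc))
        (<⇒≱ (length≤degree ⟨ part i ⟩
          (triple-unique (RimNeighbours.x≢y N) (RimNeighbours.x≢z N) (RimNeighbours.y≢z N))
          (ux∈ ∷ uy∈ ∷ uc ∷ [])))

    spoke-part : Fin n → Fin k
    spoke-part x = proj₁ (cover (rim~centre (inject₁<n x)))

    spoke-in : ∀ {x i} → spoke-part x ≡ i → Has i (inject₁ x) centre
    spoke-in {x} refl = proj₂ (cover (rim~centre (inject₁<n x)))

    -- Three spokes in one part would give the centre degree 3, so the premises clash; the equation
    -- is just the form in which the fibre count expects this.
    spoke-parts≤2 : ∀ {x y z} → toℕ x < toℕ y → toℕ y < toℕ z →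
                    spoke-part x ≡ spoke-part y → spoke-part y ≡ spoke-part z → x ≡ y
    spoke-parts≤2 {x} {y} {z} x<y y<z fx≡fy fy≡fz = contradiction
      (spoke⇒degree≤2 (part i) (regular i) xc)
      (<⇒≱ (length≤degree ⟨ part i ⟩
        (triple-unique (apart x<y) (apart (<-trans x<y y<z)) (apart y<z))
        (has-sym xc ∷ has-sym yc ∷ has-sym zc ∷ [])))
      where
      i = spoke-part y
      xc = spoke-in fx≡fy
      yc = spoke-in {y} refl
      zc = spoke-in (sym fy≡fz)
      apart : ∀ {a b : Fin n} → toℕ a < toℕ b → inject₁ a ≢ inject₁ b
      apart a<b eq = <⇒≢ a<b (cong toℕ (F.inject₁-injective eq))

    -- The `n` spokes fill at most two slots in each part and at most one in the sparse part, so
    -- `suc n ≤ k * 2`; now halve.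
    ⌈p/2⌉≤k : ⌈ suc n /2⌉ ≤ k
    ⌈p/2⌉≤k with j , sparse ← sparse-part = ≤-trans
      (⌈n/2⌉-mono (fibres≤2⇒size<2k spoke-part spoke-parts≤2 j
        (λ fx≡j fy≡j → F.inject₁-injective (sparse (spoke-in fx≡j) (spoke-in fy≡j)))))
      (≤-reflexive (trans (cong ⌈_/2⌉ (trans (*-comm k 2) (cong (k +_) (+-identityʳ k))))
                          (sym (n≡⌈n+n/2⌉ k))))

  -- The edge colouring for the upper bound.

  -- Colour 0 is the matching {2t, 2t + 1}, which contains the spoke at n - 1
  -- when n is odd. All other edges at a rim vertex a get the colour hue a, so
  -- that the positive colours are triangles through the centre, except that
  -- for odd n the last one is a 4-cycle.
  Paired : ℕ → ℕ → Set
  Paired a b = ⌊ a /2⌋ ≡ ⌊ b /2⌋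

  hue : ℕ → ℕ
  -- This is also the hue of `n - 1`, the other end of the closing edge.
  hue zero    = ⌊ n /2⌋
  hue (suc a) = ⌈ suc a /2⌉

  colour : ℕ → ℕ → ℕ
  colour a b with ⌊ a /2⌋ ≟ ⌊ b /2⌋
  ... | yes _ = 0
  -- The centre has the largest number, so on a spoke the minimum selects the rim end.
  ... | no _  = hue (a ⊓ b)

  colour-paired : ∀ {a b} → Paired a b → colour a b ≡ 0
  colour-paired {a} {b} ab with ⌊ a /2⌋ ≟ ⌊ b /2⌋
  ... | yes _  = refl
  ... | no ¬ab = contradiction ab ¬ab

  colour-unpaired : ∀ {a b} → ¬ Paired a b → colour a b ≡ hue (a ⊓ b)
  colour-unpaired {a} {b} ¬ab with ⌊ a /2⌋ ≟ ⌊ b /2⌋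
  ... | yes ab = contradiction ab ¬ab
  ... | no _   = refl

  colour-comm : ∀ a b → colour a b ≡ colour b a
  colour-comm a b with ⌊ a /2⌋ ≟ ⌊ b /2⌋
  ... | yes ab = sym (colour-paired (sym ab))
  ... | no ¬ab = trans (cong hue (⊓-comm a b)) (sym (colour-unpaired (¬ab ∘ sym)))

  2≤⌊n/2⌋ : 2 ≤ ⌊ n /2⌋
  2≤⌊n/2⌋ = ⌊n/2⌋-mono 4≤n

  0<hue : ∀ a → 0 < hue a
  0<hue zero    = ≤-trans (s≤s z≤n) 2≤⌊n/2⌋
  0<hue (suc a) = s≤s z≤n

  hue≤⌊n/2⌋ : ∀ {a} → a < n → hue a ≤ ⌊ n /2⌋
  hue≤⌊n/2⌋ {zero}  _   = ≤-refl
  hue≤⌊n/2⌋ {suc a} a<n = ⌊n/2⌋-mono a<n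

  follows⇒hue-source : ∀ {a b} → Follows a b → hue (a ⊓ b) ≡ hue a
  follows⇒hue-source {a} (inj₁ (refl , _)) = cong hue (m≤n⇒m⊓n≡m (n≤1+n a))
  follows⇒hue-source {zero}  (inj₂ (1≡n , _))        = contradiction (sym 1≡n) (n≢ (s≤s (s≤s z≤n)))
  follows⇒hue-source {suc a} (inj₂ (2+a≡n , refl)) = cong ⌊_/2⌋ (sym 2+a≡n)

  -- An unpaired step from `a` to `suc a` has `a` odd, and then both have the same upper half.
  follows⇒hue-target : ∀ {a b} → Follows a b → ¬ Paired a b → hue (a ⊓ b) ≡ hue b
  follows⇒hue-target {zero}  (inj₁ (refl , _)) ¬ab = contradiction refl ¬ab
  follows⇒hue-target {suc a} ab@(inj₁ (refl , _)) ¬ab with half-step (suc a)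
  ... | inj₁ eq = contradiction (sym eq) ¬ab
  ... | inj₂ eq = trans (follows⇒hue-source ab) eq
  follows⇒hue-target {a} (inj₂ (_ , refl)) _ = cong hue (⊓-zeroʳ a)

  -- The ends of an unpaired rim edge have equal hues, so it does not matter which of them the
  -- minimum selects.
  colour-rim : ∀ {a b} → Adjacent a b → ¬ Paired a b → a < n → colour a b ≡ hue a
  colour-rim {a} {b} adj ¬ab a<n = trans (colour-unpaired ¬ab) (min-hue adj)
    where
    min-hue : Adjacent a b → hue (a ⊓ b) ≡ hue a
    min-hue (inj₁ ab)                      = follows⇒hue-source ab
    min-hue (inj₂ (inj₁ ba))               =
      trans (cong hue (⊓-comm a b)) (follows⇒hue-target ba (¬ab ∘ sym))
    min-hue (inj₂ (inj₂ (inj₁ (_ , refl)))) = cong hue (m≤n⇒m⊓n≡m (<⇒≤ a<n))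
    min-hue (inj₂ (inj₂ (inj₂ (_ , a≡n)))) = contradiction a≡n (<⇒≢ a<n)

  colour-bound : ∀ {a b} → Adjacent a b → colour a b < ⌈ suc n /2⌉
  colour-bound {a} {b} adj with ⌊ a /2⌋ ≟ ⌊ b /2⌋
  ... | yes _ = s≤s z≤n
  -- By computation `⌈ suc n /2⌉` is `suc ⌊ n /2⌋`: one colour for the matching and one for each
  -- hue.
  ... | no _  = s≤s (hue≤⌊n/2⌋ (min<n adj))
    where
    min<n : Adjacent a b → a ⊓ b < n
    min<n (inj₁ ab)                      = m<n⇒m⊓o<n b (follows-source ab)
    min<n (inj₂ (inj₁ ba))               = m<n⇒o⊓m<n a (follows-source ba)
    min<n (inj₂ (inj₂ (inj₁ (a<n , _)))) = m<n⇒m⊓o<n b a<n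
    min<n (inj₂ (inj₂ (inj₂ (b<n , _)))) = m<n⇒o⊓m<n a b<n

  colour≡0⇒paired : ∀ {a b} → colour a b ≡ 0 → Paired a b
  colour≡0⇒paired {a} {b} c≡0 with ⌊ a /2⌋ ≟ ⌊ b /2⌋
  ... | yes ab = ab
  ... | no _   = contradiction (sym c≡0) (<⇒≢ (0<hue (a ⊓ b)))

  colour≡suc⇒unpaired : ∀ {a b j} → colour a b ≡ suc j → ¬ Paired a b
  colour≡suc⇒unpaired c≡ ab with () ← trans (sym c≡) (colour-paired ab)

  -- Describes the spokes of colour `suc j` by their rim ends. The middle condition discards the
  -- matched spoke at `n - 1`, present when `n` is odd.
  HueSpoke : ℕ → ℕ → Set
  HueSpoke j a = a < n × ¬ Paired a n × hue a ≡ suc j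

  TwoHueSpokes : ℕ → Set
  TwoHueSpokes j = ∃₂ λ a b → a ≢ b × HueSpoke j a × HueSpoke j b ×
                   (∀ {c} → HueSpoke j c → c ≡ a ⊎ c ≡ b)

  -- The rim ends are `2j + 1` and `2j + 2`. For the last hue, `2j + 2` is the centre or its
  -- partner, and vertex 0 takes its place.
  hue-spokes : ∀ j → suc j ≤ ⌊ n /2⌋ → TwoHueSpokes j
  hue-spokes j j<h = second (m≤n⇒m<n∨m≡n j<h)
    where
    a = suc (j + j)

    ⌊a/2⌋≡j : ⌊ a /2⌋ ≡ j
    ⌊a/2⌋≡j = sym (n≡⌈n+n/2⌉ j)

    hue-a : hue a ≡ suc j
    hue-a = cong suc (sym (n≡⌊n+n/2⌋ j))

    hue-1+a : hue (suc a) ≡ suc j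
    hue-1+a = cong suc ⌊a/2⌋≡j

    below : ∀ {b} → ⌊ b /2⌋ < ⌊ n /2⌋ → hue b ≡ suc j → HueSpoke j b
    below b< hb = half-cancel-< b< , <⇒≢ b< , hb

    spoke-a : HueSpoke j a
    spoke-a = below (subst (_< ⌊ n /2⌋) (sym ⌊a/2⌋≡j) j<h) hue-a

    a-or-1+a : ∀ {c} → ⌈ suc c /2⌉ ≡ suc j → suc c ≡ a ⊎ suc c ≡ suc a
    a-or-1+a {c} hc
      -- An upper half is the lower half of the successor, hence the shift by one.
      with half-fibre (suc a) (suc (suc a)) (suc (suc c)) (trans hue-a (sym hue-1+a))
                                                          (trans hue-a (sym hc))
    ... | inj₁ eq        = contradiction (sym eq) 1+n≢n
    ... | inj₂ (inj₁ eq) = inj₁ (suc-injective (sym eq))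
    ... | inj₂ (inj₂ eq) = inj₂ (suc-injective (sym eq))

    second : suc j < ⌊ n /2⌋ ⊎ suc j ≡ ⌊ n /2⌋ → TwoHueSpokes j
    second (inj₁ 1+j<h) = a , suc a , 1+n≢n ∘ sym , spoke-a ,
      below (subst (_< ⌊ n /2⌋) (sym (cong suc (sym (n≡⌊n+n/2⌋ j)))) 1+j<h) hue-1+a , cover
      where
      cover : ∀ {c} → HueSpoke j c → c ≡ a ⊎ c ≡ suc a
      cover {zero}  (_ , _ , hc) = contradiction (sym hc) (<⇒≢ 1+j<h)
      cover {suc c} (_ , _ , hc) = a-or-1+a hc
    second (inj₂ 1+j≡h) = a , 0 , (λ ()) , spoke-a ,
      below (≤-trans (s≤s z≤n) j<h) (sym 1+j≡h) , cover
      where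
      cover : ∀ {c} → HueSpoke j c → c ≡ a ⊎ c ≡ 0
      cover {zero}  _ = inj₂ refl
      cover {suc c} (_ , ¬cn , hc) with a-or-1+a hc
      ... | inj₁ c≡a   = inj₁ c≡a
      -- Here `suc c` is `suc a`, whose lower half is `hue a` and so that of `n`: it is paired with
      -- the centre.
      ... | inj₂ refl  = contradiction (trans hue-a 1+j≡h) ¬cn

  -- Regularity of the colour classes.

  Matched : Fin (suc n) → Fin (suc n) → Set
  Matched u v = Paired (toℕ u) (toℕ v)

  -- A pair has two members, and one of them is `u` itself.
  matched-unique : ∀ {u v w} → u ~ v → Matched u v → u ~ w → Matched u w → w ≡ v
  matched-unique {u} {v} {w} u~v uv u~w uw with half-fibre (toℕ u) (toℕ v) (toℕ w) uv uw
  ... | inj₁ eq        = contradiction (subst (u ~_) (sym (F.toℕ-injective eq)) u~v) (Graph.~-irrefl W)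
  ... | inj₂ (inj₁ eq) = contradiction (subst (u ~_) (sym (F.toℕ-injective eq)) u~w) (Graph.~-irrefl W)
  ... | inj₂ (inj₂ eq) = sym (F.toℕ-injective eq)

  -- An even rim vertex is matched to its successor, or to the centre if it is `n - 1`; an odd one
  -- is matched to its predecessor.
  partner-first : ∀ {u} → toℕ u < n → ∃ λ x → ∃₂ λ y z → RimNeighbours u x y z × Matched u x
  partner-first {u} u<n with v , uv ← successor u<n with t , tu ← predecessor u<n
    with half-step (toℕ u) | uv | tu
  ... | inj₁ eq | inj₁ (v≡ , _)    | _ =
    v , t , centre , rim-neighbours uv tu , sym (trans (cong ⌊_/2⌋ v≡) eq)
  ... | inj₁ eq | inj₂ (1+u≡n , _) | _ =
    centre , v , t , rotate (rim-neighbours uv tu) ,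
    sym (trans (cong ⌊_/2⌋ (trans (F.toℕ-fromℕ n) (sym 1+u≡n))) eq)
  ... | inj₂ eq | _ | inj₁ (u≡ , _) =
    t , v , centre , swap₁₂ (rim-neighbours uv tu) ,
    suc-injective (trans (sym eq) (cong (λ a → ⌊ suc a /2⌋) u≡))
  ... | inj₂ eq | _ | inj₂ (_ , u≡0)
    with () ← subst (λ a → ⌊ suc a /2⌋ ≡ suc ⌊ a /2⌋) u≡0 eq

  Class : ℕ → Fin (suc n) → Fin (suc n) → Set
  Class i u v = u ~ v × colour (toℕ u) (toℕ v) ≡ i

  class : ℕ → EdgeSet W
  class i = record
    { Has     = Class i
    ; has?    = λ u v → Graph._~?_ W u v ×-dec (colour (toℕ u) (toℕ v) ≟ i)
    ; has-sym = λ {u} {v} (uv , c≡i) → Graph.~-sym W uv , trans (colour-comm (toℕ v) (toℕ u)) c≡i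
    ; has⇒~   = proj₁
    }

  class0-degree : ∀ {u v} → Class 0 u v → Graph.degree ⟨ class 0 ⟩ u ≡ 1
  class0-degree uv@(u~v , c≡0) = degree≡length ⟨ class 0 ⟩ ([] ∷ []) (uv ∷ [])
    λ (u~w , c′≡0) → here (matched-unique u~v (colour≡0⇒paired c≡0) u~w (colour≡0⇒paired c′≡0))

  -- Besides the matched edge, `u` has two edges, and by `colour-rim` both share the colour of the
  -- given edge `u v`.
  class-rim-degree : ∀ {j u v} → Class (suc j) u v → toℕ u < n → Graph.degree ⟨ class (suc j) ⟩ u ≡ 2
  class-rim-degree {j} {u} (u~v , c≡) u<n
    with x , y , z , N , ux ← partner-first u<n = degree≡length ⟨ class (suc j) ⟩ (pair-unique y≢z)
      (in-class y~ (x≢y ∘ sym) ∷ in-class z~ (x≢z ∘ sym) ∷ []) cover′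
    where
    open RimNeighbours N
    in-class : ∀ {w} → u ~ w → w ≢ x → Class (suc j) u w
    in-class u~w w≢x = u~w ,
      trans (colour-rim (~⇒Adjacent u~w) (λ uw → w≢x (matched-unique x~ ux u~w uw)) u<n)
            (trans (sym (colour-rim (~⇒Adjacent u~v) (colour≡suc⇒unpaired c≡) u<n)) c≡)
    cover′ : ∀ {w} → Class (suc j) u w → w ∈ y ∷ z ∷ []
    cover′ (u~w , c′≡) with cover u~w
    ... | here refl = contradiction ux (colour≡suc⇒unpaired c′≡)
    ... | there w∈  = w∈

  HueSpoke⇒Class : ∀ {j} {u : Fin (suc n)} → HueSpoke j (toℕ u) → Class (suc j) u centre
  HueSpoke⇒Class {u = u} (u<n , ¬un , h≡) = rim~centre u<n ,
    trans (colour-rim (~⇒Adjacent (rim~centre u<n))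
                      (subst (¬_ ∘ Paired (toℕ u)) (sym (F.toℕ-fromℕ n)) ¬un) u<n) h≡

  Class⇒HueSpoke : ∀ {j} {u : Fin (suc n)} → Class (suc j) u centre → HueSpoke j (toℕ u)
  Class⇒HueSpoke {u = u} (u~c , c≡) = u<n , subst (¬_ ∘ Paired (toℕ u)) (F.toℕ-fromℕ n) ¬uc ,
    trans (sym (colour-rim (~⇒Adjacent u~c) ¬uc u<n)) c≡
    where
    u<n = ~centre⇒rim u~c
    ¬uc = colour≡suc⇒unpaired c≡

  class-centre-degree : ∀ {j} → suc j ≤ ⌊ n /2⌋ → Graph.degree ⟨ class (suc j) ⟩ centre ≡ 2
  class-centre-degree {j} j<h
    with _ , _ , a≢b , sa , sb , only ← hue-spokes j j<h
    with x , refl ← vertex (proj₁ sa) with y , refl ← vertex (proj₁ sb)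
    = degree≡length ⟨ class (suc j) ⟩ (pair-unique (a≢b ∘ cong toℕ))
        (class-sym (HueSpoke⇒Class sa) ∷ class-sym (HueSpoke⇒Class sb) ∷ [])
        (λ cw → locate (only (Class⇒HueSpoke (class-sym cw))))
    where
    class-sym : ∀ {u v} → Class (suc j) u v → Class (suc j) v u
    class-sym = EdgeSet.has-sym (class (suc j))
    locate : ∀ {w x y : Fin (suc n)} → toℕ w ≡ toℕ x ⊎ toℕ w ≡ toℕ y → w ∈ x ∷ y ∷ []
    locate (inj₁ w≡x) = here (F.toℕ-injective w≡x)
    locate (inj₂ w≡y) = there (here (F.toℕ-injective w≡y))

  class-regular : ∀ i → i < ⌈ suc n /2⌉ → Regular ⟨ class i ⟩
  class-regular i i<k = valency i , λ {v} v∈V →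
    degree≡ i i<k (proj₂ (∈-comprehension⁻ (λ u → F.any? (EdgeSet.has? (class i) u)) v∈V))
    where
    valency : ℕ → ℕ
    valency zero    = 1
    valency (suc _) = 2
    degree≡ : ∀ i → i < ⌈ suc n /2⌉ → ∀ {u v} → Class i u v → Graph.degree ⟨ class i ⟩ u ≡ valency i
    degree≡ zero    _         uv = class0-degree uv
    degree≡ (suc j) (s≤s j<h) {u} uv with m≤n⇒m<n∨m≡n (F.toℕ≤pred[n] u)
    ... | inj₁ u<n = class-rim-degree uv u<n
    ... | inj₂ u≡n = subst (λ u → Graph.degree ⟨ class (suc j) ⟩ u ≡ 2) (sym (toℕ≡n⇒centre u≡n))
                           (class-centre-degree j<h)

  class-nonempty : ∀ i → i < ⌈ suc n /2⌉ → ∃₂ (Class i)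
  class-nonempty zero    _ with v , v≡ ← vertex {1} (≤-trans (s≤s (s≤s z≤n)) 4≤n) =
    zero , v , Adjacent⇒~ (inj₁ (inj₁ (v≡ , subst (_< n) (sym v≡) (≤-trans (s≤s (s≤s z≤n)) 4≤n)))) ,
    colour-paired {0} (cong ⌊_/2⌋ (sym v≡))
  class-nonempty (suc j) (s≤s j<h)
    with _ , _ , _ , sa , _ ← hue-spokes j j<h with x , refl ← vertex (proj₁ sa)
    = x , centre , HueSpoke⇒Class sa

  ⌈p/2⌉-partition : RegularlyPartitionable W ⌈ suc n /2⌉
  ⌈p/2⌉-partition = record
    { part     = class ∘ toℕ
    ; nonempty = λ i → class-nonempty (toℕ i) (F.toℕ<n i)
    ; disjoint = λ (_ , c≡i) (_ , c≡j) → F.toℕ-injective (trans (sym c≡i) c≡j)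
    ; cover    = λ uv → let c<k = colour-bound (~⇒Adjacent uv)
                        in fromℕ< c<k , uv , sym (F.toℕ-fromℕ< c<k)
    } , λ i → class-regular (toℕ i) (F.toℕ<n i)

proposition1 : (p : ℕ) (5≤p : 5 ≤ p) → IsRegularNumber (wheel p (<⇒≤ 5≤p)) ⌈ p /2⌉
proposition1 (suc n) 5≤p =
  ⌈p/2⌉-partition , λ k (P , regular) → LowerBound.⌈p/2⌉≤k P regular
  where open Wheel (s≤s⁻¹ 5≤p) (<⇒≤ 5≤p)
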